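{- Let $e\geqslant 1$ and $b\geqslant 2$ be integers. Suppose that $e\not\equiv 1\pmod{p-1}$ for every prime divisor $p$ of $b-1$. Then for every positive integer $m$ there exists an integer $l>0$ such that $l+1,l+2,\ldots,l+m$ are all $(e,b)$-happy.
   Context: For integers $e\geqslant 1$, $b\geqslant 2$ and a positive integer $n=\sum_{j=0}^k a_j b^j$ with $0\leqslant a_j<b$, define $T_{e,b}(n)=\sum_{j=0}^k a_j^e$ (the sum of the $e$-th powers of the base-$b$ digits of $n$). $T_{e,b}^r$ denotes the $r$-th iterate of $T_{e,b}$, with $T_{e,b}^0(n)=n$. A positive integer $n$ is called $(e,b)$-happy if $T_{e,b}^r(n)=1$ for some $r\geqslant 0$. -}

module Defs where

open import Data.Digit using (Expansion; toDigits)
open import Data.Fin.Base using (toℕ)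
open import Data.Integer.Base using (+_; _-_)
open import Data.Integer.Divisibility.Signed using (_∣_)
open import Data.List.Base using (map)
open import Data.Nat.Base using (ℕ; _<_; _^_; NonTrivial; 2+)
open import Data.Nat.GeneralisedArithmetic using (iterate)
open import Data.Nat.ListAction using (sum)
open import Data.Product.Base using (_×_; ∃-syntax; proj₁)
open import Relation.Binary.PropositionalEquality.Core using (_≡_)

infix 4 _≡_[mod_]

_≡_[mod_] : ℕ → ℕ → ℕ → Set
a ≡ b [mod n ] = (+ n) ∣ (+ a - + b)

-- Matching on b only discharges the bound that `toDigits` asks for.
digits : (b : ℕ) → .{{_ : NonTrivial b}} → ℕ → Expansion b
digits b@(2+ _) n = proj₁ (toDigits b n)

T : (e b : ℕ) → .{{_ : NonTrivial b}} → ℕ → ℕ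
T e b n = sum (map (λ a → toℕ a ^ e) (digits b n))

Happy : (e b : ℕ) → .{{_ : NonTrivial b}} → ℕ → Set
Happy e b n = 0 < n × ∃[ r ] iterate (T e b) n r ≡ 1

{-# OPTIONS --safe #-}

-- Apply moves x ↦ T (l + x) to all of 1, …, n. It suffices to send them to a common value v:
-- choose h with h + v a power of b, and pull h back through each move by writing a block of h
-- ones in front of l. Two numbers at distance d can be merged if, for some N, the images of N
-- and N + d are at a distance which is mergeable. Put m = b − 1 and M = m ^ e. Carrying through t
-- digits m changes an image by 1 − t M, so only residues of d modulo M matter. As b is invertible
-- modulo M, differences add up when placed in disjoint blocks of digits. Multiples of m are
-- mergeable by moving digits 1 up one place; any residue can be sent to a multiple of m because m
-- and the numbers a ^ e − a have no common prime factor p: otherwise a ^ e ≡ a modulo p for all a,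
-- hence p − 1 divides e − 1.

module Submission where

open import Defs
import Data.Nat.Properties as ℕ

module PowersModuloPrimes where
  open import Algebra.Properties.CommutativeSemiring.Binomial ℕ.+-*-commutativeSemiring
    using (binomialTerm) renaming (theorem to binomial-theorem)
  open import Algebra.Properties.Semiring.Exp ℕ.+-*-semiring using () renaming (_^_ to _^′_)
  open import Algebra.Properties.Semiring.Mult ℕ.+-*-semiring using () renaming (_×_ to _×′_)
  open import Algebra.Properties.Semiring.Sum ℕ.+-*-semiring using (sum; sum-init-last)
  open import Data.Fin.Base using (Fin; zero; suc; toℕ; inject₁; fromℕ)
  open import Data.Fin.Properties using (toℕ-inject₁; toℕ-fromℕ; toℕ<n)
  open import Data.Integer.Base as ℤ using (ℤ; +_; _+_; _*_; _-_; _^_; 0ℤ; 1ℤ)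
  import Data.Integer.Properties as ℤ
  open import Data.Integer.Divisibility.Signed
  open import Data.Integer.Tactic.RingSolver using (solve-∀)
  open import Data.Nat.Base as ℕ using (ℕ; zero; suc; _!; _≤_; _<_; z≤n; s≤s; NonZero)
  open import Data.Nat.Combinatorics using (_C_; nCk≡n!/k![n-k]!; k![n∸k]!∣n!; nCn≡1)
  import Data.Nat.Divisibility as ℕ
  open import Data.Nat.DivMod using (m/n*n≡m; m≡m%n+[m/n]*n; m%n<n)
  open import Data.Nat.Primality using (Prime; euclidsLemma; prime⇒nonTrivial; prime⇒nonZero)
  open import Data.Product.Base using (_,_; ∃-syntax)
  open import Data.Sum.Base using (inj₁; inj₂)
  open import Relation.Binary.PropositionalEquality
  open import Relation.Nullary.Negation using (¬_; contradiction)

  -- Binomial coefficients modulo a prime and Fermat's little theorem.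

  prime∤! : ∀ {p} → Prime p → ∀ n → n < p → ¬ (p ℕ.∣ n !)
  prime∤! {p} pp zero _ p∣1 = ℕ.nonTrivial⇒≢1 {{prime⇒nonTrivial pp}} (ℕ.∣1⇒≡1 p∣1)
  prime∤! pp (suc n) n<p p∣ with euclidsLemma (suc n) (n !) pp p∣
  ... | inj₁ d = ℕ.<⇒≱ n<p (ℕ.∣⇒≤ d)
  ... | inj₂ d = prime∤! pp n (ℕ.<-trans (ℕ.n<1+n n) n<p) d

  -- `p` divides `p !`, the product of the binomial coefficient and `k ! * (p ∸ k) !`, but neither
  -- of the two factorials.
  prime∣C : ∀ {p} → Prime p → ∀ k → 0 < k → k < p → p ℕ.∣ p C k
  prime∣C {p} pp k 0<k k<p with euclidsLemma (p C k) (k ! ℕ.* (p ℕ.∸ k) !) pp p∣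
    where
    instance _ = prime⇒nonZero pp
    p∣p! : ∀ n → .{{NonZero n}} → n ℕ.∣ n !
    p∣p! (suc n) = ℕ.m∣m*n (n !)
    instance _ = k ℕ.!* (p ℕ.∸ k) !≢0
    C*k!*[p∸k]! : (p C k) ℕ.* (k ! ℕ.* (p ℕ.∸ k) !) ≡ p !
    C*k!*[p∸k]! = trans (cong (ℕ._* (k ! ℕ.* (p ℕ.∸ k) !)) (nCk≡n!/k![n-k]! (ℕ.<⇒≤ k<p)))
                        (m/n*n≡m (k![n∸k]!∣n! (ℕ.<⇒≤ k<p)))
    p∣ : p ℕ.∣ (p C k) ℕ.* (k ! ℕ.* (p ℕ.∸ k) !)
    p∣ = subst (p ℕ.∣_) (sym C*k!*[p∸k]!) (p∣p! p)
  ... | inj₁ d = d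
  ... | inj₂ d with euclidsLemma (k !) ((p ℕ.∸ k) !) pp d
  ...   | inj₁ d′ = contradiction d′ (prime∤! pp k k<p)
  ...   | inj₂ d′ = contradiction d′ (prime∤! pp (p ℕ.∸ k) (ℕ.∸-monoʳ-< 0<k (ℕ.<⇒≤ k<p)))

  ∣-sum : ∀ {d n} (f : Fin n → ℕ) → (∀ i → d ℕ.∣ f i) → d ℕ.∣ sum f
  ∣-sum {n = zero}  f d∣f = _ ℕ.∣0
  ∣-sum {n = suc n} f d∣f = ℕ.∣m∣n⇒∣m+n (d∣f zero) (∣-sum (λ i → f (suc i)) (λ i → d∣f (suc i)))

  ^′≡^ : ∀ x n → x ^′ n ≡ x ℕ.^ n
  ^′≡^ x zero    = refl
  ^′≡^ x (suc n) = cong (x ℕ.*_) (^′≡^ x n)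

  ×′≡* : ∀ n x → n ×′ x ≡ n ℕ.* x
  ×′≡* zero    x = refl
  ×′≡* (suc n) x = cong (x ℕ.+_) (×′≡* n x)

  binomialTerm-1 : ∀ x n k → binomialTerm x 1 n k ≡ (n C toℕ k) ℕ.* x ℕ.^ toℕ k
  binomialTerm-1 x n k = begin
    (n C toℕ k) ×′ (x ^′ toℕ k ℕ.* 1 ^′ (n ℕ.∸ toℕ k))   ≡⟨ ×′≡* (n C toℕ k) _ ⟩
    (n C toℕ k) ℕ.* (x ^′ toℕ k ℕ.* 1 ^′ (n ℕ.∸ toℕ k))
      ≡⟨ cong₂ (λ u v → (n C toℕ k) ℕ.* (u ℕ.* v)) (^′≡^ x (toℕ k))
           (trans (^′≡^ 1 (n ℕ.∸ toℕ k)) (ℕ.^-zeroˡ (n ℕ.∸ toℕ k))) ⟩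
    (n C toℕ k) ℕ.* (x ℕ.^ toℕ k ℕ.* 1)                   ≡⟨ cong ((n C toℕ k) ℕ.*_) (ℕ.*-identityʳ _) ⟩
    (n C toℕ k) ℕ.* x ℕ.^ toℕ k                            ∎
    where open ≡-Reasoning

  -- The interior binomial coefficients are multiples of `p`. The witness `c` avoids subtraction, so
  -- the binomial theorem in ℕ suffices.
  frobenius : ∀ {p} → Prime p → ∀ x → ∃[ c ] (x ℕ.+ 1) ℕ.^ p ≡ 1 ℕ.+ c ℕ.* p ℕ.+ x ℕ.^ p
  frobenius {zero}  pp x = contradiction refl (ℕ.≢-nonZero⁻¹ 0 {{prime⇒nonZero pp}})
  frobenius {suc n} pp x = ℕ.quotient p∣middle , (begin
    (x ℕ.+ 1) ℕ.^ p                         ≡⟨ ^′≡^ (x ℕ.+ 1) p ⟨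
    (x ℕ.+ 1) ^′ p                          ≡⟨ binomial-theorem p x 1 ⟩
    t zero ℕ.+ sum (λ i → t (suc i))        ≡⟨ cong₂ ℕ._+_ (binomialTerm-1 x p zero) (sum-init-last (λ i → t (suc i))) ⟩
    1 ℕ.+ (sum middle ℕ.+ t (fromℕ p))      ≡⟨ cong₂ (λ u v → 1 ℕ.+ (u ℕ.+ v)) (ℕ._∣_.equality p∣middle) last ⟩
    1 ℕ.+ (ℕ.quotient p∣middle ℕ.* p ℕ.+ x ℕ.^ p)  ≡⟨ ℕ.+-assoc 1 _ (x ℕ.^ p) ⟨
    1 ℕ.+ ℕ.quotient p∣middle ℕ.* p ℕ.+ x ℕ.^ p    ∎)
    where
    open ≡-Reasoning
    p = suc n
    t = binomialTerm x 1 p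
    middle : Fin n → ℕ
    middle i = t (suc (inject₁ i))
    p∣middle : p ℕ.∣ sum middle
    p∣middle = ∣-sum middle λ i →
      subst (p ℕ.∣_) (sym (binomialTerm-1 x p (suc (inject₁ i))))
        (ℕ.∣m⇒∣m*n _ (prime∣C pp (suc (toℕ (inject₁ i))) (s≤s z≤n)
          (s≤s (subst (_< n) (sym (toℕ-inject₁ i)) (toℕ<n i)))))
    last : t (fromℕ p) ≡ x ℕ.^ p
    last = begin
      t (fromℕ p)                                         ≡⟨ binomialTerm-1 x p (fromℕ p) ⟩
      (p C toℕ (fromℕ p)) ℕ.* x ℕ.^ toℕ (fromℕ p)          ≡⟨ cong (λ k → (p C k) ℕ.* x ℕ.^ k) (toℕ-fromℕ p) ⟩
      (p C p) ℕ.* x ℕ.^ p                                  ≡⟨ cong (ℕ._* x ℕ.^ p) (nCn≡1 p) ⟩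
      1 ℕ.* x ℕ.^ p                                        ≡⟨ ℕ.*-identityˡ _ ⟩
      x ℕ.^ p                                              ∎

  pos-^ : ∀ x n → + (x ℕ.^ n) ≡ (+ x) ^ n
  pos-^ x zero    = refl
  pos-^ x (suc n) = trans (ℤ.pos-* x (x ℕ.^ n)) (cong (+ x *_) (pos-^ x n))

  -- By `frobenius`, passing from `x` to `x + 1` changes `x ^ p - x` by a multiple of `p`.
  fermat : ∀ {p} → Prime p → ∀ x → + p ∣ (+ x) ^ p - + x
  fermat {zero}  pp x = contradiction refl (ℕ.≢-nonZero⁻¹ 0 {{prime⇒nonZero pp}})
  fermat {suc n} pp zero = divides 0ℤ (trans (ℤ.+-identityʳ (0ℤ ^ suc n)) (ℤ.*-zeroˡ (0ℤ ^ n)))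
  fermat {p@(suc _)} pp (suc x) with frobenius pp x | fermat pp x
  ... | c , eq | divides q eq′ = divides (+ c + q) (begin
    (+ suc x) ^ p - + suc x                     ≡⟨ cong (_- + suc x) lhs ⟩
    (1ℤ + + c * + p + (+ x) ^ p) - (1ℤ + + x)   ≡⟨ regroup (+ c * + p) ((+ x) ^ p) (+ x) ⟩
    + c * + p + ((+ x) ^ p - + x)               ≡⟨ cong (λ z → + c * + p + z) eq′ ⟩
    + c * + p + q * + p                         ≡⟨ ℤ.*-distribʳ-+ (+ p) (+ c) q ⟨
    (+ c + q) * + p                             ∎)
    where
    open ≡-Reasoning
    regroup : ∀ u v w → (1ℤ + u + v) - (1ℤ + w) ≡ u + (v - w)
    regroup = solve-∀
    lhs : (+ suc x) ^ p ≡ 1ℤ + + c * + p + (+ x) ^ p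
    lhs = begin
      (+ suc x) ^ p                        ≡⟨ pos-^ (suc x) p ⟨
      + (suc x ℕ.^ p)                      ≡⟨ cong (λ z → + (z ℕ.^ p)) (ℕ.+-comm 1 x) ⟩
      + ((x ℕ.+ 1) ℕ.^ p)                  ≡⟨ cong +_ eq ⟩
      1ℤ + + (c ℕ.* p) + + (x ℕ.^ p)       ≡⟨ cong₂ (λ u v → 1ℤ + u + v) (ℤ.pos-* c p) (pos-^ x p) ⟩
      1ℤ + + c * + p + (+ x) ^ p           ∎

  -- Forward differences: Δⁿ xⁿ = n! bounds the number of roots of xⁿ − 1 modulo a prime.

  Δ : (ℕ → ℤ) → ℕ → ℤ
  Δ f x = f (suc x) - f x

  Δ^ : ℕ → (ℕ → ℤ) → ℕ → ℤ
  Δ^ zero    f = f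
  Δ^ (suc n) f = Δ (Δ^ n f)

  -- Leibniz rule for the factor `y`: only two terms survive because the second differences of `y`
  -- vanish.
  Δ^-leibniz : ∀ n f x →
    Δ^ (suc n) (λ y → + y * f y) x ≡ + x * Δ^ (suc n) f x + + suc n * Δ^ n f (suc x)
  Δ^-leibniz zero f x = identity (+ x) (f (suc x)) (f x)
    where
    identity : ∀ y u v → (1ℤ + y) * u - y * v ≡ y * (u - v) + 1ℤ * u
    identity = solve-∀
  Δ^-leibniz (suc n) f x =
    trans (cong₂ _-_ (Δ^-leibniz n f (suc x)) (Δ^-leibniz n f x))
          (identity (+ x) (+ n) (Δ^ n f (suc (suc x))) (Δ^ n f (suc x)) (Δ^ n f x))
    where
    identity : ∀ y k u v w →
      ((1ℤ + y) * (u - v) + (1ℤ + k) * u) - (y * (v - w) + (1ℤ + k) * v) ≡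
      y * ((u - v) - (v - w)) + (1ℤ + (1ℤ + k)) * (u - v)
    identity = solve-∀

  Δ^-power : ∀ n x → Δ^ n (λ y → (+ y) ^ n) x ≡ + (n !)
  Δ^-power zero    x = refl
  Δ^-power (suc n) x = begin
    Δ^ (suc n) (λ y → (+ y) ^ suc n) x
      ≡⟨ Δ^-leibniz n (λ y → (+ y) ^ n) x ⟩
    + x * Δ^ (suc n) (λ y → (+ y) ^ n) x + + suc n * Δ^ n (λ y → (+ y) ^ n) (suc x)
      -- The n-th difference of `y ^ n` is the constant `n !`, so one more difference gives zero.
      ≡⟨ cong₂ (λ u v → + x * u + + suc n * v)
           (cong₂ _-_ (Δ^-power n (suc x)) (Δ^-power n x)) (Δ^-power n (suc x)) ⟩
    + x * (+ (n !) - + (n !)) + + suc n * + (n !)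
      ≡⟨ identity (+ x) (+ (n !)) (+ suc n) ⟩
    + suc n * + (n !)
      ≡⟨ ℤ.pos-* (suc n) (n !) ⟨
    + (suc n !) ∎
    where
    open ≡-Reasoning
    identity : ∀ y u k → y * (u - u) + k * u ≡ k * u
    identity = solve-∀

  -- Modulo `d` the function is constant between 0 and `m`, so its differences vanish. The one of
  -- order `suc n` at `x` reads the values from `x` to `x + suc n`, hence the bound.
  ∣-Δ^ : ∀ {d : ℤ} {m} f → (∀ y → 0 < y → y < m → d ∣ f y - 1ℤ) →
         ∀ n x → 0 < x → x ℕ.+ suc n < m → d ∣ Δ^ (suc n) f x
  ∣-Δ^ {d} {m} f h zero x 0<x x+1<m =
    subst (d ∣_) (identity (f (suc x)) (f x))
      (∣m∣n⇒∣m-n (h (suc x) (s≤s z≤n) 1+x<m) (h x 0<x (ℕ.<-trans (ℕ.n<1+n x) 1+x<m)))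
    where
    1+x<m : suc x < m
    1+x<m = subst (_< m) (ℕ.+-comm x 1) x+1<m
    identity : ∀ u v → (u - 1ℤ) - (v - 1ℤ) ≡ u - v
    identity = solve-∀
  ∣-Δ^ {d} {m} f h (suc n) x 0<x lt =
    ∣m∣n⇒∣m-n (∣-Δ^ f h n (suc x) (s≤s z≤n) lt′) (∣-Δ^ f h n x 0<x (ℕ.<-trans (ℕ.n<1+n _) lt′))
    where
    lt′ : suc (x ℕ.+ suc n) < m
    lt′ = subst (_< m) (ℕ.+-suc x (suc n)) lt

  -- Exponents that send every unit modulo a prime to 1.

  ∣-^-1 : ∀ {d} x n → d ∣ x - 1ℤ → d ∣ x ^ n - 1ℤ
  ∣-^-1 {d} x zero d∣ = divides 0ℤ (sym (ℤ.*-zeroˡ d))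
  ∣-^-1 {d} x (suc n) d∣ =
    subst (d ∣_) (identity x (x ^ n)) (∣m∣n⇒∣m+n (∣n⇒∣m*n x (∣-^-1 x n d∣)) d∣)
    where
    identity : ∀ u v → u * (v - 1ℤ) + (u - 1ℤ) ≡ u * v - 1ℤ
    identity = solve-∀

  prime∣*⇒∣ : ∀ {p} → Prime p → ∀ {a} → 0 < a → a < p → ∀ y → + p ∣ + a * y → + p ∣ y
  prime∣*⇒∣ {p} pp {suc a} 0<a a<p y p∣ay
    with euclidsLemma (suc a) ℤ.∣ y ∣ pp (subst (p ℕ.∣_) (ℤ.abs-* (+ suc a) y) (∣⇒∣ᵤ p∣ay))
  ... | inj₁ d = contradiction (ℕ.∣⇒≤ d) (ℕ.<⇒≱ a<p)
  ... | inj₂ d = ∣ᵤ⇒∣ d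

  -- Fermat reduces `n` to its remainder modulo `p - 1`. A nonzero remainder s would make `y ^ s`
  -- constant modulo `p` on the units, so `p` would divide its s-th difference `s !`, although s <
  -- p.
  units-annihilator : ∀ {p} → Prime p → ∀ n →
    (∀ a → 0 < a → a < p → + p ∣ (+ a) ^ n - 1ℤ) → (p ℕ.∸ 1) ℕ.∣ n
  units-annihilator {zero} pp = contradiction refl (ℕ.≢-nonZero⁻¹ 0 {{prime⇒nonZero pp}})
  units-annihilator {suc zero} pp = contradiction refl (ℕ.nonTrivial⇒≢1 {{prime⇒nonTrivial pp}})
  units-annihilator {p@(suc p′@(suc _))} pp n h with n ℕ.% p′ in r≡ | m≡m%n+[m/n]*n n p′ | m%n<n n p′
  ... | zero  | n≡ | _ = ℕ.divides (n ℕ./ p′) n≡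
  ... | suc r | n≡ | r<p′ = contradiction p∣r! (prime∤! pp (suc r) (ℕ.<-trans r<p′ (ℕ.n<1+n p′)))
    where
    q = n ℕ./ p′
    reduce : ∀ a → 0 < a → a < p → + p ∣ (+ a) ^ suc r - 1ℤ
    reduce a 0<a a<p = ∣m+n∣m⇒∣n
      (subst (+ p ∣_) (trans (cong (_- 1ℤ) split) (identity ((+ a) ^ suc r) (((+ a) ^ p′) ^ q))) (h a 0<a a<p))
      (∣n⇒∣m*n ((+ a) ^ suc r) (∣-^-1 ((+ a) ^ p′) q
        (prime∣*⇒∣ pp 0<a a<p _ (subst (+ p ∣_) (identity′ (+ a) ((+ a) ^ p′)) (fermat pp a)))))
      where
      identity : ∀ u v → u * v - 1ℤ ≡ u * (v - 1ℤ) + (u - 1ℤ)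
      identity = solve-∀
      identity′ : ∀ u v → u * v - u ≡ u * (v - 1ℤ)
      identity′ = solve-∀
      split : (+ a) ^ n ≡ (+ a) ^ suc r * ((+ a) ^ p′) ^ q
      split = begin
        (+ a) ^ n                              ≡⟨ cong ((+ a) ^_) n≡ ⟩
        (+ a) ^ (suc r ℕ.+ q ℕ.* p′)           ≡⟨ ℤ.^-distribˡ-+-* (+ a) (suc r) (q ℕ.* p′) ⟩
        (+ a) ^ suc r * (+ a) ^ (q ℕ.* p′)     ≡⟨ cong (λ k → (+ a) ^ suc r * (+ a) ^ k) (ℕ.*-comm q p′) ⟩
        (+ a) ^ suc r * (+ a) ^ (p′ ℕ.* q)     ≡⟨ cong ((+ a) ^ suc r *_) (ℤ.^-*-assoc (+ a) p′ q) ⟨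
        (+ a) ^ suc r * ((+ a) ^ p′) ^ q       ∎
        where open ≡-Reasoning
    p∣r! : p ℕ.∣ suc r !
    p∣r! = ∣⇒∣ᵤ (subst (+ p ∣_) (Δ^-power (suc r) 1)
      -- Only the values at 1 to r + 2 enter, and `r<p′` says that r + 2 is at most p - 1.
      (∣-Δ^ (λ y → (+ y) ^ suc r) reduce r 1 (s≤s z≤n) (s≤s r<p′)))

  n≤n^[1+k] : ∀ n k → n ≤ n ℕ.^ suc k
  n≤n^[1+k] zero      k = z≤n
  n≤n^[1+k] n@(suc _) k = ℕ.m≤m*n n (n ℕ.^ k) {{ℕ.m^n≢0 n k}}

  -- For `0 < a < p` the factor `a` cancels from `a * (a ^ n - 1)`, which leaves the situation of
  -- `units-annihilator`.
  fixes-residues⇒≡1 : ∀ {p} → Prime p → ∀ n →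
    (∀ a → a < p → p ℕ.∣ a ℕ.^ suc n ℕ.∸ a) → suc n ≡ 1 [mod (p ℕ.∸ 1) ]
  fixes-residues⇒≡1 {p} pp n h = ∣ᵤ⇒∣ (units-annihilator pp n λ a 0<a a<p →
    prime∣*⇒∣ pp 0<a a<p _ (subst (+ p ∣_) (difference a) (∣ᵤ⇒∣ (h a a<p))))
    where
    open ≡-Reasoning
    identity : ∀ u v → u * v - u ≡ u * (v - 1ℤ)
    identity = solve-∀
    difference : ∀ a → + (a ℕ.^ suc n ℕ.∸ a) ≡ + a * ((+ a) ^ n - 1ℤ)
    difference a = begin
      + (a ℕ.^ suc n ℕ.∸ a)     ≡⟨ ℤ.⊖-≥ (n≤n^[1+k] a n) ⟨
      a ℕ.^ suc n ℤ.⊖ a         ≡⟨ ℤ.m-n≡m⊖n (a ℕ.^ suc n) a ⟨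
      + (a ℕ.^ suc n) - + a     ≡⟨ cong (_- + a) (pos-^ a (suc n)) ⟩
      + a * (+ a) ^ n - + a     ≡⟨ identity (+ a) ((+ a) ^ n) ⟩
      + a * ((+ a) ^ n - 1ℤ)    ∎

open PowersModuloPrimes using (n≤n^[1+k]; fixes-residues⇒≡1)

open import Data.Digit using (Expansion; fromDigits; toDigits)
open import Data.Fin.Base using (toℕ; fromℕ<)
open import Data.Fin.Properties using (toℕ<n; toℕ-fromℕ<)
open import Data.List.Base using (List; []; _∷_; _++_; map)
open import Data.List.Relation.Unary.All using (_∷_)
open import Data.Nat.Base
open import Data.Nat.DivMod using (m<n⇒m%n≡m; [m+kn]%n≡m%n; m≡m%n+[m/n]*n; m%n<n; m<n*o⇒m/o<n)
open import Data.Nat.Divisibility using (_∣_; m∣m*n; ∣-refl; ∣-trans; ∣⇒≤; 0∣⇒≡0)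
open import Data.Nat.GCD using (gcd; gcd-GCD; gcd[m,n]∣m; gcd[m,n]∣n; module Bézout)
open import Data.Nat.GeneralisedArithmetic using (iterate)
open import Data.Nat.ListAction using (sum; product)
open import Data.Nat.Primality using (Prime)
open import Data.Nat.Primality.Factorisation using (factorise)
open import Data.Nat.Properties
open import Data.Nat.Tactic.RingSolver using (solve-∀)
open import Data.Product.Base using (_×_; _,_; ∃-syntax; proj₂)
open import Data.Sum.Base using (inj₁; inj₂)
open import Relation.Binary.PropositionalEquality
open import Relation.Nullary.Decidable using (yes; no)
open import Relation.Nullary.Negation using (¬_; contradiction)

-- Division by the base, powers of `1 + m` modulo powers of `m`, and common divisors.

digit-unique : ∀ {b a c x y} → a < b → c < b → a + x * b ≡ c + y * b → a ≡ c × x ≡ y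
digit-unique {b@(suc _)} {a} {c} {x} {y} a<b c<b eq = a≡c , x≡y
  where
  open ≡-Reasoning
  a≡c : a ≡ c
  a≡c = begin
    a                ≡⟨ m<n⇒m%n≡m a<b ⟨
    a % b            ≡⟨ [m+kn]%n≡m%n a x b ⟨
    (a + x * b) % b  ≡⟨ cong (_% b) eq ⟩
    (c + y * b) % b  ≡⟨ [m+kn]%n≡m%n c y b ⟩
    c % b            ≡⟨ m<n⇒m%n≡m c<b ⟩
    c                ∎
  x≡y : x ≡ y
  x≡y = *-cancelʳ-≡ x y b
    (+-cancelˡ-≡ c (x * b) (y * b) (trans (cong (_+ x * b) (sym a≡c)) eq))

[1+y]^n : ∀ y n → ∃[ z ] (1 + y) ^ n ≡ 1 + n * y + z * (y * y)
[1+y]^n y zero    = 0 , refl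
[1+y]^n y (suc n) with [1+y]^n y n
... | z , eq = n + z + z * y , trans (cong ((1 + y) *_) eq) (identity y n z)
  where
  identity : ∀ y n z → (1 + y) * (1 + n * y + z * (y * y)) ≡
                       1 + (1 + n) * y + (n + z + z * y) * (y * y)
  identity = solve-∀

-- Taking `m`-th powers lifts a congruence to 1 from modulus `m ^ (j + 1)` to `m ^ (j + 2)`: the
-- linear term gains a factor `m`, and the quadratic remainder contains `m ^ (2 * j + 2)`.
^-cong-1 : ∀ m j → ∃[ q ] (1 + m) ^ (m ^ j) ≡ 1 + q * m ^ suc j
^-cong-1 m zero    = 1 , identity m
  where
  identity : ∀ m → (1 + m) * 1 ≡ 1 + 1 * (m * 1)
  identity = solve-∀
^-cong-1 m (suc j) with ^-cong-1 m j
... | q , eq with [1+y]^n (q * m ^ suc j) m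
...   | z , eq′ = q + z * q * (q * m ^ j) , (begin
  (1 + m) ^ (m * m ^ j)                ≡⟨ cong ((1 + m) ^_) (*-comm m (m ^ j)) ⟩
  (1 + m) ^ (m ^ j * m)                ≡⟨ ^-*-assoc (1 + m) (m ^ j) m ⟨
  ((1 + m) ^ (m ^ j)) ^ m              ≡⟨ cong (_^ m) eq ⟩
  (1 + q * m ^ suc j) ^ m              ≡⟨ eq′ ⟩
  1 + m * (q * m ^ suc j) + z * (q * m ^ suc j * (q * m ^ suc j))
                                       ≡⟨ identity m q z (m ^ j) ⟩
  1 + (q + z * q * (q * m ^ j)) * m ^ suc (suc j) ∎)
  where
  open ≡-Reasoning
  identity : ∀ m q z w → 1 + m * (q * (m * w)) + z * (q * (m * w) * (q * (m * w))) ≡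
                         1 + (q + z * q * (q * w)) * (m * (m * w))
  identity = solve-∀

n<m^n : ∀ m → 1 < m → ∀ n → n < m ^ n
n<m^n m 1<m zero    = s≤s z≤n
n<m^n m 1<m (suc n) = ≤-<-trans (n<m^n m 1<m n) (^-monoʳ-< m 1<m (n<1+n n))

bounded : ∀ (f : ℕ → ℕ) n → ∃[ B ] (∀ x → x ≤ n → f x ≤ B)
bounded f zero = f 0 , λ { zero z≤n → ≤-refl }
bounded f (suc n) with bounded f n
... | B , h = B ⊔ f (suc n) , bound
  where
  bound : ∀ x → x ≤ suc n → f x ≤ B ⊔ f (suc n)
  bound x x≤ with m≤n⇒m<n∨m≡n x≤
  ... | inj₁ (s≤s x≤n) = ≤-trans (h x x≤n) (m≤m⊔n B (f (suc n)))
  ... | inj₂ refl      = m≤n⊔m B (f (suc n))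

prime-divisor : ∀ n → .{{NonZero n}} → n ≢ 1 → ∃[ p ] (Prime p × p ∣ n)
prime-divisor n n≢1 with factorise n
... | record { factors = [] ; isFactorisation = n≡1 } = contradiction n≡1 n≢1
... | record { factors = p ∷ ps ; isFactorisation = eq ; factorsPrime = pp ∷ _ } =
  p , pp , subst (p ∣_) (sym eq) (m∣m*n (product ps))

common-divisor≡1 : ∀ n k → (∀ p → Prime p → p ∣ suc n → ¬ (suc k ≡ 1 [mod (p ∸ 1) ])) →
  ∀ {g} → g ∣ suc n → (∀ a → a < 2+ n → g ∣ a ^ suc k ∸ a) → g ≡ 1
common-divisor≡1 n k incongruent {zero} 0∣1+n g∣ = contradiction (0∣⇒≡0 0∣1+n) λ ()
common-divisor≡1 n k incongruent {g@(suc _)} g∣1+n g∣ with g ≟ 1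
... | yes g≡1 = g≡1
... | no  g≢1 = let p , pp , p∣g = prime-divisor g g≢1
                    p∣1+n = ∣-trans p∣g g∣1+n
                in contradiction
  -- Since `p ≤ suc n < 2+ n`, the assumption on `g` covers every residue modulo `p`.
  (fixes-residues⇒≡1 pp k λ a a<p → ∣-trans p∣g (g∣ a (<-trans (<-≤-trans a<p (∣⇒≤ p∣1+n)) (n<1+n (suc n)))))
  (incongruent p pp p∣1+n)

-- The digit recursion of `T`.

module _ (k m′ : ℕ) where

  private
    e b : ℕ
    e = suc k
    b = 2+ m′

  powerSum : Expansion b → ℕ
  powerSum ds = sum (map (λ a → toℕ a ^ e) ds)

  -- Expansions of one number differ only in leading zeros, which contribute `0 ^ suc k`, that is 0.
  -- Hence any expansion may be used, not just the one from `toDigits`.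
  powerSum-cong : ∀ ds es → fromDigits ds ≡ fromDigits es → powerSum ds ≡ powerSum es
  powerSum-cong [] [] eq = refl
  powerSum-cong [] (d ∷ ds) eq with digit-unique {x = 0} (s≤s z≤n) (toℕ<n d) eq
  ... | 0≡d , 0≡ds = cong₂ (λ x y → x ^ e + y) 0≡d (powerSum-cong [] ds 0≡ds)
  powerSum-cong (d ∷ ds) [] eq with digit-unique {y = 0} (toℕ<n d) (s≤s z≤n) eq
  ... | d≡0 , ds≡0 = cong₂ (λ x y → x ^ e + y) d≡0 (powerSum-cong ds [] ds≡0)
  powerSum-cong (d ∷ ds) (c ∷ cs) eq with digit-unique (toℕ<n d) (toℕ<n c) eq
  ... | d≡c , ds≡cs = cong₂ (λ x y → x ^ e + y) d≡c (powerSum-cong ds cs ds≡cs)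

  fromDigits-digits : ∀ n → fromDigits (digits b n) ≡ n
  fromDigits-digits n = proj₂ (toDigits b n)

  T-fromDigits : ∀ ds → T e b (fromDigits ds) ≡ powerSum ds
  T-fromDigits ds = powerSum-cong (digits b (fromDigits ds)) ds (fromDigits-digits (fromDigits ds))

  T-cons : ∀ a u → a < b → T e b (a + u * b) ≡ a ^ e + T e b u
  T-cons a u a<b = begin
    T e b (a + u * b)
      ≡⟨ cong₂ (λ x y → T e b (x + y * b)) (toℕ-fromℕ< a<b) (fromDigits-digits u) ⟨
    T e b (fromDigits (fromℕ< a<b ∷ digits b u))
      ≡⟨ T-fromDigits (fromℕ< a<b ∷ digits b u) ⟩
    toℕ (fromℕ< a<b) ^ e + T e b u
      ≡⟨ cong (λ x → x ^ e + T e b u) (toℕ-fromℕ< a<b) ⟩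
    a ^ e + T e b u  ∎
    where open ≡-Reasoning

  T-0 : T e b 0 ≡ 0
  T-0 = T-fromDigits []

-- S stands for T e b; it is a parameter so that toDigits is never unfolded.
module _ (k m′ : ℕ) (S : ℕ → ℕ) (S-0 : S 0 ≡ 0)
  (S-cons : ∀ a u → a < 2+ m′ → S (a + u * 2+ m′) ≡ a ^ suc k + S u)
  where

  private
    e m b M : ℕ
    e = suc k
    m = suc m′
    b = suc m
    M = m ^ e

    1<b : 1 < b
    1<b = s≤s (s≤s z≤n)

    instance
      M≢0 : NonZero M
      M≢0 = m^n≢0 m e

  -- Values on blocks of digits.

  S-digit : ∀ a → a < b → S a ≡ a ^ e
  S-digit a a<b = begin
    S a          ≡⟨ cong S (+-identityʳ a) ⟨
    S (a + 0)    ≡⟨ S-cons a 0 a<b ⟩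
    a ^ e + S 0  ≡⟨ cong (_+_ (a ^ e)) S-0 ⟩
    a ^ e + 0    ≡⟨ +-identityʳ (a ^ e) ⟩
    a ^ e        ∎
    where open ≡-Reasoning

  S-1 : S 1 ≡ 1
  S-1 = trans (S-digit 1 1<b) (^-zeroˡ e)

  -- `v` fits into the lowest `K` places and `u` is written above them, so nothing carries.
  S-shift : ∀ K u v → v < b ^ K → S (v + u * b ^ K) ≡ S v + S u
  S-shift zero    u zero v<1 = trans (cong S (*-identityʳ u)) (cong (_+ S u) (sym S-0))
  S-shift zero    u (suc v) (s≤s ())
  S-shift (suc K) u v v<b^1+K = begin
    S (v + u * b ^ suc K)               ≡⟨ cong (λ x → S (x + u * b ^ suc K)) v≡ ⟩
    S (r + q * b + u * (b * b ^ K))     ≡⟨ cong S (identity r q u b (b ^ K)) ⟩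
    S (r + (q + u * b ^ K) * b)         ≡⟨ S-cons r (q + u * b ^ K) (m%n<n v b) ⟩
    r ^ e + S (q + u * b ^ K)           ≡⟨ cong (_+_ (r ^ e)) (S-shift K u q q<b^K) ⟩
    r ^ e + (S q + S u)                 ≡⟨ +-assoc (r ^ e) (S q) (S u) ⟨
    r ^ e + S q + S u                   ≡⟨ cong (_+ S u) (S-cons r q (m%n<n v b)) ⟨
    S (r + q * b) + S u                 ≡⟨ cong (λ x → S x + S u) v≡ ⟨
    S v + S u                           ∎
    where
    open ≡-Reasoning
    r = v % b
    q = v / b
    v≡ : v ≡ r + q * b
    v≡ = m≡m%n+[m/n]*n v b
    q<b^K : q < b ^ K
    q<b^K = m<n*o⇒m/o<n (subst (v <_) (*-comm b (b ^ K)) v<b^1+K)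
    identity : ∀ r q u b w → r + q * b + u * (b * w) ≡ r + (q + u * w) * b
    identity = solve-∀

  S-high : ∀ K v → v < b ^ K → S (v + b ^ K) ≡ S v + 1
  S-high K v v<b^K = begin
    S (v + b ^ K)      ≡⟨ cong (λ x → S (v + x)) (*-identityˡ (b ^ K)) ⟨
    S (v + 1 * b ^ K)  ≡⟨ S-shift K 1 v v<b^K ⟩
    S v + S 1          ≡⟨ cong (_+_ (S v)) S-1 ⟩
    S v + 1            ∎
    where open ≡-Reasoning

  S-b^ : ∀ K → S (b ^ K) ≡ 1
  S-b^ K = trans (S-high K 0 (m^n>0 b K)) (cong (_+ 1) S-0)

  -- Repunits in base `b`, used as preimages of prescribed values under `S`.
  ones : ℕ → ℕ
  ones zero    = 0
  ones (suc n) = 1 + ones n * b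

  S-ones : ∀ n → S (ones n) ≡ n
  S-ones zero    = S-0
  S-ones (suc n) = trans (S-cons 1 (ones n) 1<b) (cong₂ _+_ (^-zeroˡ e) (S-ones n))

  -- `b ^ n ∸ 1` is written with `n` digits, all equal to `m`.
  S-b^∸1 : ∀ n → S (b ^ n ∸ 1) ≡ n * M
  S-b^∸1 zero    = S-0
  S-b^∸1 (suc n) = begin
    S (b ^ suc n ∸ 1)         ≡⟨ cong (λ x → S (b * x ∸ 1)) b^n≡ ⟩
    S (b * suc x ∸ 1)         ≡⟨ cong (λ y → S (y ∸ 1)) (identity m x) ⟩
    S (m + x * b)             ≡⟨ S-cons m x (n<1+n m) ⟩
    M + S x                   ≡⟨ cong (_+_ M) (S-b^∸1 n) ⟩
    M + n * M                 ∎
    where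
    open ≡-Reasoning
    x = b ^ n ∸ 1
    b^n≡ : b ^ n ≡ suc x
    b^n≡ = sym (m+[n∸m]≡n (m^n>0 b n))
    identity : ∀ m x → (1 + m) * (1 + x) ≡ 1 + (m + x * (1 + m))
    identity = solve-∀

  -- Moves and mergeable distances.

  act : List ℕ → ℕ → ℕ
  act []       x = x
  act (l ∷ ls) x = act ls (S (l + x))

  act-++ : ∀ ls ls′ x → act (ls ++ ls′) x ≡ act ls′ (act ls x)
  act-++ []       ls′ x = refl
  act-++ (l ∷ ls) ls′ x = act-++ ls ls′ (S (l + x))

  -- The list may depend on `x`. Only the distance matters, because a shift carries `x` to any
  -- larger number.
  Mergeable : ℕ → Set
  Mergeable d = ∀ x → ∃[ ls ] act ls x ≡ act ls (x + d)

  mergeable-0 : Mergeable 0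
  mergeable-0 x = [] , sym (+-identityʳ x)

  -- The shift takes `x` to `N + b ^ K` and `x + d` to `N + d + b ^ K`. The top digit 1 leaves room
  -- for a natural shift when `x` exceeds `N`, and adds 1 to both images. The image of `x` is the
  -- larger one, so the two points exchange roles.
  mergeable-step : ∀ {d d′} N → Mergeable d′ → S N ≡ S (N + d) + d′ → Mergeable d
  mergeable-step {d} {d′} N h eq x with h (S (N + d) + 1)
  ... | ls , eq′ = l ∷ ls , (begin
    act ls (S (l + x))                ≡⟨ cong (act ls) image₀ ⟩
    act ls (S (N + d) + 1 + d′)       ≡⟨ eq′ ⟨
    act ls (S (N + d) + 1)            ≡⟨ cong (act ls) image₁ ⟨
    act ls (S (l + (x + d)))          ∎)
    where
    open ≡-Reasoning
    K = N + d + x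
    l = N + (b ^ K ∸ x)
    K<b^K : K < b ^ K
    K<b^K = n<m^n b 1<b K
    l+x≡ : l + x ≡ N + b ^ K
    l+x≡ = trans (+-assoc N (b ^ K ∸ x) x)
      (cong (N +_) (m∸n+n≡m (≤-trans (m≤n+m x (N + d)) (<⇒≤ K<b^K))))
    swap : ∀ u v w → u + v + w ≡ u + w + v
    swap = solve-∀
    image₀ : S (l + x) ≡ S (N + d) + 1 + d′
    image₀ = begin
      S (l + x)            ≡⟨ cong S l+x≡ ⟩
      S (N + b ^ K)        ≡⟨ S-high K N (≤-<-trans (≤-trans (m≤m+n N d) (m≤m+n (N + d) x)) K<b^K) ⟩
      S N + 1              ≡⟨ cong (_+ 1) eq ⟩
      S (N + d) + d′ + 1   ≡⟨ swap (S (N + d)) d′ 1 ⟩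
      S (N + d) + 1 + d′   ∎
    image₁ : S (l + (x + d)) ≡ S (N + d) + 1
    image₁ = begin
      S (l + (x + d))      ≡⟨ cong S (+-assoc l x d) ⟨
      S (l + x + d)        ≡⟨ cong (λ y → S (y + d)) l+x≡ ⟩
      S (N + b ^ K + d)    ≡⟨ cong S (swap N (b ^ K) d) ⟩
      S (N + d + b ^ K)    ≡⟨ S-high K (N + d) (≤-<-trans (m≤m+n (N + d) x) K<b^K) ⟩
      S (N + d) + 1        ∎

  -- Distances modulo `M` and the changes of image they allow.

  -- The field image says S (N + d) − S N = u − t M. Fixing d only up to multiples of M leaves
  -- room to shift blocks of digits.
  record Reach (c u t : ℕ) : Set where
    constructor reach
    field
      {d N} j : ℕ
      d≡      : d ≡ c + j * M
      image   : S (N + d) + t * M ≡ S N + u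

  -- In the exponent, `m ^ k` gives the congruence and the factor `n` the size. A block moved up `K`
  -- places thus clears `n` and keeps its residue modulo `M`.
  b^-cong-1 : ∀ n → ∃[ K ] ∃[ q ] (n < b ^ K × b ^ K ≡ 1 + q * M)
  b^-cong-1 n with ^-cong-1 m k
  ... | q , eq with [1+y]^n (q * M) n
  ...   | z , eq′ = m ^ k * n , n * q + z * q * (q * M) ,
    <-≤-trans (n<m^n b 1<b n) (^-monoʳ-≤ b (m≤n*m n (m ^ k) {{m^n≢0 m k}})) , (begin
      b ^ (m ^ k * n)                              ≡⟨ ^-*-assoc b (m ^ k) n ⟨
      (b ^ (m ^ k)) ^ n                            ≡⟨ cong (_^ n) eq ⟩
      (1 + q * M) ^ n                              ≡⟨ eq′ ⟩
      1 + n * (q * M) + z * (q * M * (q * M))      ≡⟨ identity n q z M ⟩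
      1 + (n * q + z * q * (q * M)) * M            ∎)
    where
    open ≡-Reasoning
    identity : ∀ n q z w → 1 + n * (q * w) + z * (q * w * (q * w)) ≡ 1 + (n * q + z * q * (q * w)) * w
    identity = solve-∀

  -- The second pair is written above all digits of `N + d`, so the images add. Its distance is
  -- multiplied by `b ^ K`, which is 1 modulo `M`.
  reach-+ : ∀ {c u t c′ u′ t′} → Reach c u t → Reach c′ u′ t′ → Reach (c + c′) (u + u′) (t + t′)
  reach-+ {c} {u} {t} {c′} {u′} {t′} (reach {d} {N} j d≡ im) (reach {d′} {N′} j′ d′≡ im′)
    with b^-cong-1 (N + d)
  ... | K , q , N+d<b^K , b^K≡ =
    reach {d = d + d′ * b ^ K} {N = N + N′ * b ^ K} (j + j′ + d′ * q) shifted (begin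
      S (N + N′ * b ^ K + (d + d′ * b ^ K)) + (t + t′) * M
        ≡⟨ cong (λ x → S x + (t + t′) * M) (regroup N N′ d d′ (b ^ K)) ⟩
      S (N + d + (N′ + d′) * b ^ K) + (t + t′) * M
        ≡⟨ cong (_+ (t + t′) * M) (S-shift K (N′ + d′) (N + d) N+d<b^K) ⟩
      S (N + d) + S (N′ + d′) + (t + t′) * M
        ≡⟨ distribute (S (N + d)) (S (N′ + d′)) t t′ M ⟩
      (S (N + d) + t * M) + (S (N′ + d′) + t′ * M)
        ≡⟨ cong₂ _+_ im im′ ⟩
      (S N + u) + (S N′ + u′)
        ≡⟨ exchange (S N) u (S N′) u′ ⟩
      (S N + S N′) + (u + u′)
        ≡⟨ cong (_+ (u + u′)) (S-shift K N′ N (≤-<-trans (m≤m+n N d) N+d<b^K)) ⟨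
      S (N + N′ * b ^ K) + (u + u′) ∎)
    where
    open ≡-Reasoning
    regroup : ∀ n n′ d d′ w → n + n′ * w + (d + d′ * w) ≡ n + d + (n′ + d′) * w
    regroup = solve-∀
    distribute : ∀ x y t t′ w → x + y + (t + t′) * w ≡ (x + t * w) + (y + t′ * w)
    distribute = solve-∀
    exchange : ∀ x u y v → (x + u) + (y + v) ≡ (x + y) + (u + v)
    exchange = solve-∀
    identity₁ : ∀ d d′ q w → d + d′ * (1 + q * w) ≡ d + d′ + d′ * q * w
    identity₁ = solve-∀
    identity₂ : ∀ c j c′ j′ x w → (c + j * w) + (c′ + j′ * w) + x * w ≡ c + c′ + (j + j′ + x) * w
    identity₂ = solve-∀
    shifted : d + d′ * b ^ K ≡ c + c′ + (j + j′ + d′ * q) * M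
    shifted = begin
      d + d′ * b ^ K                              ≡⟨ cong (λ x → d + d′ * x) b^K≡ ⟩
      d + d′ * (1 + q * M)                        ≡⟨ identity₁ d d′ q M ⟩
      d + d′ + d′ * q * M                         ≡⟨ cong₂ (λ x y → x + y + d′ * q * M) d≡ d′≡ ⟩
      (c + j * M) + (c′ + j′ * M) + d′ * q * M    ≡⟨ identity₂ c j c′ j′ (d′ * q) M ⟩
      c + c′ + (j + j′ + d′ * q) * M              ∎

  -- Adding 1 to a number with `t` digits `m` carries through all of them: the image goes from
  -- `t * M` to 1.
  reach-b^ : ∀ t → Reach 1 1 t
  reach-b^ t = reach {N = b ^ t ∸ 1} 0 refl (begin
    S (b ^ t ∸ 1 + 1) + t * M  ≡⟨ cong (λ x → S x + t * M) (m∸n+n≡m (m^n>0 b t)) ⟩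
    S (b ^ t) + t * M          ≡⟨ cong (_+ t * M) (S-b^ t) ⟩
    1 + t * M                  ≡⟨ +-comm 1 (t * M) ⟩
    t * M + 1                  ≡⟨ cong (_+ 1) (S-b^∸1 t) ⟨
    S (b ^ t ∸ 1) + 1          ∎)
    where open ≡-Reasoning

  reach-digit : ∀ a → a < b → Reach a (a ^ e) 0
  reach-digit a a<b = reach {N = 0} 0 (sym (+-identityʳ a))
    (trans (+-identityʳ (S a)) (trans (S-digit a a<b) (cong (_+ a ^ e) (sym S-0))))

  -- Moving a digit 1 up one place adds b − 1 and does not change the image.
  reach-move : Reach m 0 0
  reach-move = reach {N = 1} 0 (sym (+-identityʳ m))
    (cong (_+ 0) (trans (cong S (sym (*-identityʳ b))) (trans (S-b^ 1) (sym S-1))))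

  reach-* : ∀ n {c u t} → Reach c u t → Reach (n * c) (n * u) (n * t)
  reach-* zero    r = reach {N = 0} 0 refl refl
  reach-* (suc n) r = reach-+ r (reach-* n r)

  reach-copies : ∀ n → Reach n n 0
  reach-copies n = subst₂ (λ x y → Reach x x y) (*-identityʳ n) (*-zeroʳ n) (reach-* n (reach-b^ 0))

  -- Copies of `reach-move` leave the image unchanged, so a single move merges.
  mergeable-multiple : ∀ n → ∃[ j ] Mergeable (n * m + j * M)
  mergeable-multiple n with subst₂ (Reach (n * m)) (*-zeroʳ n) (*-zeroʳ n) (reach-* n reach-move)
  ... | reach {N = N} j refl im = j , mergeable-step N mergeable-0
    (trans (sym (+-identityʳ (S N))) (sym im))

  -- Attainable changes of image modulo `m`.

  -- At distance 0 modulo `M`, such a change corrects an image without affecting the residue of the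
  -- distance. Modulo `m` these changes form a subgroup; `i` makes up for the lack of subtraction.
  Attains : ℕ → Set
  Attains v = ∃[ c ] ∃[ i ] Reach (c * M) (v + i * m) 0

  attains-+ : ∀ {v w} → Attains v → Attains w → Attains (v + w)
  attains-+ {v} {w} (c , i , r) (c′ , i′ , r′) = c + c′ , i + i′ ,
    subst₂ (λ x y → Reach x y 0) (sym (*-distribʳ-+ M c c′)) (identity v i w i′ m) (reach-+ r r′)
    where
    identity : ∀ v i w i′ m → (v + i * m) + (w + i′ * m) ≡ v + w + (i + i′) * m
    identity = solve-∀

  attains-* : ∀ n {v} → Attains v → Attains (n * v)
  attains-* zero    _  = 0 , 0 , reach {N = 0} 0 refl refl
  attains-* (suc n) at = attains-+ at (attains-* n at)

  attains-mod : ∀ {v} n → Attains (v + n * m) → Attains v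
  attains-mod {v} n (c , i , r) = c , n + i , subst (λ x → Reach (c * M) x 0) (identity v n i m) r
    where
    identity : ∀ v n i m → v + n * m + i * m ≡ v + (n + i) * m
    identity = solve-∀

  -- Modulo m, multiplying by m′ = m − 1 is negation.
  attains-difference : ∀ {g v w} x y → g + y * w ≡ x * v → Attains v → Attains w → Attains g
  attains-difference {g} {v} {w} x y eq av aw = attains-mod (y * w)
    (subst Attains (trans (cong (_+ y * m′ * w) (sym eq)) (identity g y w m′))
      (attains-+ (attains-* x av) (attains-* (y * m′) aw)))
    where
    identity : ∀ g y w n → g + y * w + y * n * w ≡ g + y * w * (1 + n)
    identity = solve-∀

  attains-gcd : ∀ {v w} → Attains v → Attains w → Attains (gcd v w)
  attains-gcd {v} {w} av aw with Bézout.identity (gcd-GCD v w)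
  ... | Bézout.+- x y eq = attains-difference x y eq av aw
  ... | Bézout.-+ x y eq = attains-difference y x eq aw av

  attains-m : Attains m
  attains-m = m , pred M , subst (λ x → Reach (m * M) x 0) m*M≡ (reach-copies (m * M))
    where
    m*M≡ : m * M ≡ m + pred M * m
    m*M≡ = trans (*-comm m M) (cong (_* m) (sym (suc-pred M)))

  -- The digit `a` changes the image by `a ^ e`. Then `a * (M - 1)` units complete the distance to
  -- `a * M` and contribute `- a` modulo `m`, as `m` divides `M`.
  attains-power : ∀ a → a < b → Attains (a ^ e ∸ a)
  attains-power a a<b = a , a * m ^ k ,
    subst₂ (λ x y → Reach x y 0) c≡ u≡ (reach-+ (reach-digit a a<b) (reach-copies (a * pred M)))
    where
    open ≡-Reasoning
    c≡ : a + a * pred M ≡ a * M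
    c≡ = trans (sym (*-suc a (pred M))) (cong (a *_) (suc-pred M))
    identity : ∀ a m w → a * (m * w) ≡ a * w * m
    identity = solve-∀
    u≡ : a ^ e + a * pred M ≡ a ^ e ∸ a + a * m ^ k * m
    u≡ = begin
      a ^ e + a * pred M              ≡⟨ cong (_+ a * pred M) (m∸n+n≡m (n≤n^[1+k] a k)) ⟨
      a ^ e ∸ a + a + a * pred M      ≡⟨ +-assoc (a ^ e ∸ a) a (a * pred M) ⟩
      a ^ e ∸ a + (a + a * pred M)    ≡⟨ cong (_+_ (a ^ e ∸ a)) (trans c≡ (identity a m (m ^ k))) ⟩
      a ^ e ∸ a + a * m ^ k * m       ∎

  attains-common-divisor : ∀ n → n ≤ b → ∃[ g ] (Attains g × g ∣ m × (∀ a → a < n → g ∣ a ^ e ∸ a))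
  attains-common-divisor zero    _ = m , attains-m , ∣-refl , λ _ ()
  attains-common-divisor (suc n) n<b with attains-common-divisor n (<⇒≤ n<b)
  ... | g , at , g∣m , g∣ = gcd g w , attains-gcd at (attains-power n n<b) ,
    ∣-trans (gcd[m,n]∣m g w) g∣m , divides-all
    where
    w = n ^ e ∸ n
    divides-all : ∀ a → a < suc n → gcd g w ∣ a ^ e ∸ a
    divides-all a (s≤s a≤n) with m≤n⇒m<n∨m≡n a≤n
    ... | inj₁ a<n  = ∣-trans (gcd[m,n]∣m g w) (g∣ a a<n)
    ... | inj₂ refl = gcd[m,n]∣n g w

  -- Pulling happiness back through moves.

  -- The shift found for the remaining moves is added to every image by that many digits 1 in front
  -- of `l`. The bound `B` gives one place `K` above all the numbers `l + x`.
  act-happy : ∀ ls B v h → 0 < h → ∃[ r ] iterate S (h + v) r ≡ 1 →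
    ∃[ l ] (0 < l × (∀ x → x ≤ B → act ls x ≡ v → ∃[ r ] iterate S (l + x) r ≡ 1))
  act-happy []       B v h 0<h hv = h , 0<h , λ { x _ refl → hv }
  act-happy (l ∷ ls) B v h 0<h hv with bounded (λ x → S (l + x)) B
  ... | B′ , bound with act-happy ls B′ v h 0<h hv
  -- Positivity of the later shift makes the repunit nonzero, so the new shift is positive even if
  -- `l` is 0.
  ...   | suc l′ , _ , happy = l + u * b ^ K , ≤-trans (m^n>0 b K) (≤-trans (m≤m+n (b ^ K) _) (m≤n+m _ l)) ,
    λ x x≤B eq → let r , p = happy (S (l + x)) (bound x x≤B) eq in
      suc r , trans (cong (λ y → iterate S y r) (image x x≤B)) p
    where
    open ≡-Reasoning
    K = l + B
    u = ones (suc l′)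
    swap : ∀ x y z → x + y + z ≡ x + z + y
    swap = solve-∀
    image : ∀ x → x ≤ B → S (l + u * b ^ K + x) ≡ suc l′ + S (l + x)
    image x x≤B = begin
      S (l + u * b ^ K + x)   ≡⟨ cong S (swap l (u * b ^ K) x) ⟩
      S (l + x + u * b ^ K)   ≡⟨ S-shift K u (l + x) (≤-<-trans (+-monoʳ-≤ l x≤B) (n<m^n b 1<b K)) ⟩
      S (l + x) + S u         ≡⟨ cong (S (l + x) +_) (S-ones (suc l′)) ⟩
      S (l + x) + suc l′      ≡⟨ +-comm (S (l + x)) (suc l′) ⟩
      suc l′ + S (l + x)      ∎

  -- Merging arbitrary distances.

  module _ (incongruent : ∀ p → Prime p → p ∣ m → ¬ (e ≡ 1 [mod (p ∸ 1) ])) where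

    attains-1 : Attains 1
    attains-1 = let g , at , g∣m , g∣ = attains-common-divisor b ≤-refl in
      subst Attains (common-divisor≡1 m′ k incongruent g∣m g∣) at

    -- `C` units change the image by `C`, and attaining `C * m′` completes this to a multiple of
    -- `m`. A further `M` units do not affect the residue of the distance; one of them carries
    -- through `t` digits, so `t` is free while `c` and `q` stay fixed.
    reach-multiple : ∀ C → ∃[ c ] ∃[ q ] (∀ t → Reach (C + c * M) (q * m) t)
    reach-multiple C = let c , i , r = attains-* (C * m′) attains-1 in
      suc c , C + i + m ^ k , λ t → subst₂ (λ x y → Reach x y t) (c≡ c) (u≡ i)
        (reach-+ (reach-copies C) (reach-+ r (reach-+ (reach-copies (pred M)) (reach-b^ t))))
      where
      open ≡-Reasoning
      pred+1 : pred M + 1 ≡ M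
      pred+1 = trans (+-comm (pred M) 1) (suc-pred M)
      c≡ : ∀ c → C + (c * M + (pred M + 1)) ≡ C + suc c * M
      c≡ c = cong (C +_) (trans (cong (c * M +_) pred+1) (+-comm (c * M) M))
      identity : ∀ C n i w → C + (C * n * 1 + i * (1 + n) + (1 + n) * w) ≡ (C + i + w) * (1 + n)
      identity = solve-∀
      u≡ : ∀ i → C + (C * m′ * 1 + i * m + (pred M + 1)) ≡ (C + i + m ^ k) * m
      u≡ i = begin
        C + (C * m′ * 1 + i * m + (pred M + 1))  ≡⟨ cong (λ x → C + (C * m′ * 1 + i * m + x)) pred+1 ⟩
        C + (C * m′ * 1 + i * m + M)             ≡⟨ identity C m′ i (m ^ k) ⟩
        (C + i + m ^ k) * m                      ∎

    mergeable-residue : ∀ C → ∃[ j ] Mergeable (C + j * M)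
    mergeable-residue C =
      let c , q , r = reach-multiple C
          i , merge = mergeable-multiple (q * pred M)
          -- Carrying through `q * m + i` digits turns the rise `q * m` into a fall of
          -- `q * (M - 1) * m + i * M`, the distance that `merge` handles.
          reach {d} {N} j d≡ im = r (q * m + i)
      in c + j , subst Mergeable (trans d≡ (identity C c j M))
           (mergeable-step N merge (cancel (S (N + d)) (S N) q i im))
      where
      open ≡-Reasoning
      identity : ∀ C c j w → C + c * w + j * w ≡ C + (c + j) * w
      identity = solve-∀
      regroup : ∀ x q n m y → x + (q * n * m + y) + q * m ≡ x + (q * m * (1 + n) + y)
      regroup = solve-∀
      cancel : ∀ x y q i → x + (q * m + i) * M ≡ y + q * m → y ≡ x + (q * pred M * m + i * M)
      cancel x y q i eq = +-cancelʳ-≡ (q * m) y (x + (q * pred M * m + i * M)) (begin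
        y + q * m                              ≡⟨ eq ⟨
        x + (q * m + i) * M                    ≡⟨ cong (x +_) (*-distribʳ-+ M (q * m) i) ⟩
        x + (q * m * M + i * M)                ≡⟨ cong (λ z → x + (q * m * z + i * M)) (suc-pred M) ⟨
        x + (q * m * suc (pred M) + i * M)     ≡⟨ regroup x q (pred M) m (i * M) ⟨
        x + (q * pred M * m + i * M) + q * m   ∎)

    -- Adding `suc d` to `b ^ K ∸ 1` lowers the image from `K * M` to `S d + 1`. Increasing `K` adds
    -- multiples of `M` to the fall, so `K` can be adapted to the `j` that `mergeable-residue`
    -- returns.
    mergeable : ∀ d → Mergeable d
    mergeable zero = mergeable-0
    mergeable (suc d) =
      -- Modulo `M` this is `- (S d + 1)`. The summand `d * M` raises the exponent to secure
      -- `d < b ^ exponent j`.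
      let j , merge = mergeable-residue (suc (S d) * pred M + d * M)
      in mergeable-step (b ^ exponent j ∸ 1) merge (drop j)
      where
      open ≡-Reasoning
      exponent : ℕ → ℕ
      exponent j = suc (S d) + d + j
      expand : ∀ u d j w → (u + d + j) * w ≡ u * w + (d * w + j * w)
      expand = solve-∀
      regroup : ∀ s n x y → (1 + s) * (1 + n) + (x + y) ≡ s + 1 + ((1 + s) * n + x + y)
      regroup = solve-∀
      swap : ∀ x d → x + (1 + d) ≡ d + (x + 1)
      swap = solve-∀
      image : ∀ K → d < b ^ K → S (b ^ K ∸ 1 + suc d) ≡ S d + 1
      image K d<b^K = begin
        S (b ^ K ∸ 1 + suc d)    ≡⟨ cong S (swap (b ^ K ∸ 1) d) ⟩
        S (d + (b ^ K ∸ 1 + 1))  ≡⟨ cong (λ x → S (d + x)) (m∸n+n≡m (m^n>0 b K)) ⟩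
        S (d + b ^ K)            ≡⟨ S-high K d d<b^K ⟩
        S d + 1                  ∎
      d<b^ : ∀ j → d < b ^ exponent j
      d<b^ j = ≤-<-trans (≤-trans (m≤n+m d (suc (S d))) (m≤m+n _ j)) (n<m^n b 1<b (exponent j))
      drop : ∀ j → S (b ^ exponent j ∸ 1) ≡
                   S (b ^ exponent j ∸ 1 + suc d) + (suc (S d) * pred M + d * M + j * M)
      drop j = begin
        S (b ^ exponent j ∸ 1)                          ≡⟨ S-b^∸1 (exponent j) ⟩
        exponent j * M                                  ≡⟨ expand (suc (S d)) d j M ⟩
        suc (S d) * M + (d * M + j * M)
          ≡⟨ cong (λ x → suc (S d) * x + (d * M + j * M)) (suc-pred M) ⟨
        suc (S d) * suc (pred M) + (d * M + j * M)      ≡⟨ regroup (S d) (pred M) (d * M) (j * M) ⟩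
        S d + 1 + (suc (S d) * pred M + d * M + j * M)
          ≡⟨ cong (_+ (suc (S d) * pred M + d * M + j * M)) (image (exponent j) (d<b^ j)) ⟨
        S (b ^ exponent j ∸ 1 + suc d) + (suc (S d) * pred M + d * M + j * M) ∎

    merge-pair : ∀ x y → ∃[ ls ] act ls x ≡ act ls y
    merge-pair x y with ≤-total x y
    ... | inj₁ x≤y = let ls , eq = mergeable (y ∸ x) x in
      ls , trans eq (cong (act ls) (m+[n∸m]≡n x≤y))
    ... | inj₂ y≤x = let ls , eq = mergeable (x ∸ y) y in
      ls , sym (trans eq (cong (act ls) (m+[n∸m]≡n y≤x)))

    merge-all : ∀ n → ∃[ ls ] ∃[ v ] (∀ x → x ≤ n → act ls x ≡ v)
    merge-all zero = [] , 0 , λ { zero z≤n → refl }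
    merge-all (suc n) with merge-all n
    ... | ls , v , h with merge-pair v (act ls (suc n))
    ...   | ls′ , eq = ls ++ ls′ , act ls′ v , all
      where
      all : ∀ x → x ≤ suc n → act (ls ++ ls′) x ≡ act ls′ v
      all x x≤ with m≤n⇒m<n∨m≡n x≤
      ... | inj₁ (s≤s x≤n) = trans (act-++ ls ls′ x) (cong (act ls′) (h x x≤n))
      ... | inj₂ refl      = trans (act-++ ls ls′ x) (sym eq)

    happy-interval : ∀ n → ∃[ l ] (0 < l × (∀ i → 1 ≤ i → i ≤ n → ∃[ r ] iterate S (l + i) r ≡ 1))
    happy-interval n with merge-all n
    -- Here `h + v` is `b ^ v`, which one application of `S` sends to 1.
    ... | ls , v , merged with act-happy ls n v (b ^ v ∸ v) (m<n⇒0<n∸m v<b^v)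
                                 (1 , trans (cong S (m∸n+n≡m (<⇒≤ v<b^v))) (S-b^ v))
      where
      v<b^v : v < b ^ v
      v<b^v = n<m^n b 1<b v
    ...   | l , 0<l , happy = l , 0<l , λ i _ i≤n →
      happy i i≤n (merged i i≤n)

theorem1p1 : (e b : ℕ) → .{{_ : NonZero e}} → .{{_ : NonTrivial b}} →
    (∀ p → Prime p → p ∣ (b ∸ 1) → ¬ (e ≡ 1 [mod (p ∸ 1) ])) →
    (m : ℕ) → 0 < m →
    ∃[ l ] (0 < l × (∀ i → 1 ≤ i → i ≤ m → Happy e b (l + i)))
theorem1p1 zero    b = contradiction refl (≢-nonZero⁻¹ 0)
theorem1p1 (suc k) zero = contradiction refl (≢-nonZero⁻¹ 0 {{nonTrivial⇒nonZero 0}})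
theorem1p1 (suc k) 1 = contradiction refl (nonTrivial⇒≢1 {1})
theorem1p1 (suc k) (2+ m′) incongruent n _ =
  let l , 0<l , happy = happy-interval k m′ (T (suc k) (2+ m′)) (T-0 k m′) (T-cons k m′) incongruent n
  in l , 0<l , λ i 1≤i i≤n → ≤-trans 0<l (m≤m+n l i) , happy i 1≤i i≤n
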